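{- Let $G$ be a connected split graph whose vertex set is partitioned into a clique of order $r$ and an independent set of order $s$. Then for every integer $t\ge 3$, $\varphi(G^t)=\frac{1}{2}(r+s-1)(r+s-2)$.
   Context: All graphs are finite, simple and without isolated vertices. $\mathbb{N}_0$ denotes the set of non-negative integers; for finite $A,B\subseteq\mathbb{N}_0$, $A+B=\{a+b: a\in A, b\in B\}$. An integer additive set-indexer (IASI) of a graph $G$ is an injective map $f$ from $V(G)$ to the finite non-empty subsets of $\mathbb{N}_0$ such that the induced edge map $f^+(uv)=f(u)+f(v)$ is injective on $E(G)$. A weak IASI (WIASI) is an IASI $f$ with $|f^+(uv)|=\max(|f(u)|,|f(v)|)$ for every edge $uv$ (equivalently, for every edge at least one end vertex has a singleton label). A vertex or edge is mono-indexed if its set-label has cardinality $1$. Every graph admits a WIASI. The sparing number $\varphi(G)$ is the minimum, over all WIASIs of $G$, of the number of mono-indexed edges of $G$. The $t$-th power $G^t$ has vertex set $V(G)$, two distinct vertices being adjacent iff their distance in $G$ is at most $t$. A split graph is a graph whose vertex set can be partitioned into a clique and an independent set. -}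

module Defs where

open import Data.Nat using (ℕ; zero; suc; _+_; _≤_; _<_; _⊔_; _≟_; NonZero; s≤s; s≤s⁻¹)
open import Data.Nat.Properties using (anyUpTo?; allUpTo?)
open import Data.Fin as Fin using (Fin)
import Data.Fin.Properties as Fin
open import Data.Fin.Subset using (Subset; _∈_; ∁; ∣_∣)
open import Data.List using (List; []; length; filter; deduplicate; allFin;
  cartesianProduct; cartesianProductWith)
open import Data.List.Relation.Binary.BagAndSetEquality using (_∼[_]_; set)
open import Data.Product using (∃; _×_; _,_)
open import Relation.Binary using (Decidable; Symmetric)
open import Relation.Binary.PropositionalEquality using (_≡_; _≢_; refl; sym)
open import Relation.Nullary using (¬_; Dec; ¬?; _×-dec_)
open import Relation.Nullary.Decidable using (map′)
import Relation.Unary as U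

record Graph (n : ℕ) : Set₁ where
  field
    Adj        : Fin n → Fin n → Set
    adj?       : Decidable Adj
    adj-sym    : Symmetric Adj
    adj-irrefl : ∀ {u} → ¬ Adj u u

module _ {n : ℕ} (G : Graph n) where
  open Graph G

  NoIsolatedVertices : Set
  NoIsolatedVertices = ∀ u → ∃ λ v → Adj u v

  data Walk : ℕ → Fin n → Fin n → Set where
    nil  : ∀ {u} → Walk 0 u u
    cons : ∀ {k u w v} → Adj u w → Walk k w v → Walk (suc k) u v

  record Connected : Set where
    field
      nonEmpty : NonZero n
      joined   : ∀ u v → ∃ λ k → Walk k u v

  -- No d satisfies this when u and v lie in different components.
  IsDistance : Fin n → Fin n → ℕ → Set
  IsDistance u v d = Walk d u v × (∀ {k} → k < d → ¬ Walk k u v)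

  DistanceAtMost : ℕ → Fin n → Fin n → Set
  DistanceAtMost t u v = ∃ λ d → d ≤ t × IsDistance u v d

  walk? : ∀ k → Decidable (Walk k)
  walk? zero u v = map′ (λ { refl → nil }) (λ { nil → refl }) (u Fin.≟ v)
  walk? (suc k) u v =
    map′ (λ { (_ , a , p) → cons a p }) (λ { (cons a p) → _ , a , p })
      (Fin.any? λ w → adj? u w ×-dec walk? k w v)

  isDistance? : ∀ u v d → Dec (IsDistance u v d)
  isDistance? u v d = walk? d u v ×-dec allUpTo? (λ k → ¬? (walk? k u v)) d

  distanceAtMost? : ∀ t → Decidable (DistanceAtMost t)
  distanceAtMost? t u v =
    map′ (λ { (d , d<1+t , p) → d , s≤s⁻¹ d<1+t , p })
         (λ { (d , d≤t , p) → d , s≤s d≤t , p })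
      (anyUpTo? (isDistance? u v) (suc t))

  snoc : ∀ {k u w v} → Walk k u w → Adj w v → Walk (suc k) u v
  snoc nil        b = cons b nil
  snoc (cons a p) b = cons a (snoc p b)

  reverseWalk : ∀ {k u v} → Walk k u v → Walk k v u
  reverseWalk nil        = nil
  reverseWalk (cons a p) = snoc (reverseWalk p) (adj-sym a)

  distanceAtMost-sym : ∀ {t} → Symmetric (DistanceAtMost t)
  distanceAtMost-sym (d , d≤t , p , shortest) =
    d , d≤t , reverseWalk p , λ k<d q → shortest k<d (reverseWalk q)

  power : ℕ → Graph n
  power t = record
    { Adj        = λ u v → u ≢ v × DistanceAtMost t u v
    ; adj?       = λ u v → ¬? (u Fin.≟ v) ×-dec distanceAtMost? t u v
    ; adj-sym    = λ { (u≢v , p) → (λ v≡u → u≢v (sym v≡u)) , distanceAtMost-sym p }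
    ; adj-irrefl = λ { (u≢u , _) → u≢u refl }
    }

  IsClique : Subset n → Set
  IsClique K = ∀ {u v} → u ∈ K → v ∈ K → u ≢ v → Adj u v

  IsIndependent : Subset n → Set
  IsIndependent I = ∀ {u v} → u ∈ I → v ∈ I → ¬ Adj u v

  record SplitPartition (r s : ℕ) : Set where
    field
      K           : Subset n
      clique      : IsClique K
      independent : IsIndependent (∁ K)
      ∣K∣≡r       : ∣ K ∣ ≡ r
      ∣∁K∣≡s      : ∣ ∁ K ∣ ≡ s

  -- Each unordered edge is represented once, by its endpoints in increasing order.
  IsEdge : Fin n × Fin n → Set
  IsEdge (u , v) = u Fin.< v × Adj u v

  isEdge? : U.Decidable IsEdge
  isEdge? (u , v) = u Fin.<? v ×-dec adj? u v

  edges : List (Fin n × Fin n)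
  edges = filter isEdge? (cartesianProduct (allFin n) (allFin n))

-- A finite subset of ℕ is a list of naturals taken up to _≋_: order and
-- repetitions are irrelevant, so cardinality must discard repetitions.
FinSet : Set
FinSet = List ℕ

infix 4 _≋_
_≋_ : FinSet → FinSet → Set
A ≋ B = A ∼[ set ] B

card : FinSet → ℕ
card A = length (deduplicate _≟_ A)

infixl 6 _⊕_
_⊕_ : FinSet → FinSet → FinSet
_⊕_ = cartesianProductWith _+_

module _ {n : ℕ} where

  edgeLabel : (Fin n → FinSet) → Fin n × Fin n → FinSet
  edgeLabel f (u , v) = f u ⊕ f v

  record IsIASI (G : Graph n) (f : Fin n → FinSet) : Set where
    field
      nonEmpty         : ∀ u → f u ≢ []
      vertex-injective : ∀ {u v} → f u ≋ f v → u ≡ v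
      edge-injective   : ∀ {e e′} → IsEdge G e → IsEdge G e′ →
                         edgeLabel f e ≋ edgeLabel f e′ → e ≡ e′

  record IsWIASI (G : Graph n) (f : Fin n → FinSet) : Set where
    field
      isIASI : IsIASI G f
      weak   : ∀ {u v} → Graph.Adj G u v →
               card (f u ⊕ f v) ≡ card (f u) ⊔ card (f v)

  MonoIndexed : (Fin n → FinSet) → Fin n × Fin n → Set
  MonoIndexed f e = card (edgeLabel f e) ≡ 1

  monoIndexed? : ∀ f → U.Decidable (MonoIndexed f)
  monoIndexed? f e = card (edgeLabel f e) ≟ 1

  monoIndexedEdgeCount : Graph n → (Fin n → FinSet) → ℕ
  monoIndexedEdgeCount G f =
    length (filter (monoIndexed? f) (edges G))

  -- φ(G) as a relation: the minimum ranges over infinitely many labellings,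
  -- so it is specified as an attained lower bound.
  record IsSparingNumber (G : Graph n) (m : ℕ) : Set where
    field
      attained : ∃ λ f → IsWIASI G f × monoIndexedEdgeCount G f ≡ m
      minimal  : ∀ f → IsWIASI G f → m ≤ monoIndexedEdgeCount G f

{-# OPTIONS --safe #-}

-- Every vertex of G lies in the clique or next to it, so any two vertices are
-- at distance at most 3 and Gᵗ is complete. In a complete graph on n vertices
-- a weak IASI leaves at most one vertex u₀ with a non-singleton label, because
-- |A + B| > |A| as soon as A ≠ ∅ and |B| ≥ 2; hence all (n-1)(n-2)/2 edges
-- avoiding u₀ are mono-indexed. The labels {0,1}, {2}, {4}, {8}, … attain this.
module Submission where

open import Defs
open import Data.Nat using (ℕ; _+_; _∸_; _*_; _/_; _≤_)
open import Data.Nat using (zero; suc; _<_; _^_; _⊔_; _≟_; z≤n; s≤s; z<s; s<s)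
open import Data.Nat.Properties
open import Data.Nat.DivMod using (m*n/n≡m)
open import Data.Nat.Induction using (<-rec)
open import Data.Nat.Tactic.RingSolver using (solve-∀)
open import Data.Fin as Fin using (Fin; zero; suc; toℕ; punchIn)
import Data.Fin.Properties as Fin
import Data.Fin.Subset as Subset
import Data.Fin.Subset.Properties as Subset
open import Data.List using (List; []; _∷_; [_]; _++_; map; length; lookup; filter; allFin;
  cartesianProduct; deduplicate)
open import Data.List.Extrema ≤-totalOrder using (max; argmax-sel; xs≤max; ⊥≤max)
open import Data.List.Properties using (filter-accept; length-map; length-++; length-tabulate)
open import Data.List.Membership.Propositional using (_∈_)
open import Data.List.Membership.Propositional.Properties
open import Data.List.Relation.Binary.Subset.Propositional using (_⊆_)
import Data.List.Relation.Unary.All as All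
import Data.List.Relation.Unary.All.Properties as All
open import Data.List.Relation.Unary.AllPairs using ([]; _∷_)
open import Data.List.Relation.Unary.Any using (here; there; index)
open import Data.List.Relation.Unary.Any.Properties using (lookup-index)
open import Data.List.Relation.Unary.Unique.Propositional using (Unique)
open import Data.List.Relation.Unary.Unique.Propositional.Properties
  using (map⁺; ++⁺; filter⁺; cartesianProduct⁺; allFin⁺)
open import Data.List.Relation.Unary.Unique.DecPropositional.Properties _≟_ using (deduplicate-!)
open import Data.Product using (∃; ∃₂; _×_; _,_; proj₁; proj₂)
import Data.Product as Product
open import Data.Product.Properties using (,-injective)
open import Data.Sum using (inj₁; inj₂)
open import Function using (_∘_; id)
open import Function.Bundles using (Equivalence)
open import Function.Construct.Symmetry using (⇔-sym)
open import Relation.Binary.Definitions using (tri<; tri≈; tri>)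
open import Relation.Binary.PropositionalEquality
  using (_≡_; _≢_; refl; sym; trans; cong; cong₂; subst; module ≡-Reasoning)
open import Relation.Nullary using (¬_; yes; no; ¬?; contradiction)
open import Relation.Nullary.Decidable using (decidable-stable)

-- Lists without repetitions

module _ {A : Set} where

  lookup-injective : ∀ {xs : List A} → Unique xs → ∀ i j → lookup xs i ≡ lookup xs j → i ≡ j
  lookup-injective (_  ∷ _)   zero    zero    _  = refl
  lookup-injective (x∉ ∷ _)   zero    (suc j) eq = contradiction eq (All.lookup x∉ (∈-lookup j))
  lookup-injective (x∉ ∷ _)   (suc i) zero    eq = contradiction (sym eq) (All.lookup x∉ (∈-lookup i))
  lookup-injective (_  ∷ xs!) (suc i) (suc j) eq = cong suc (lookup-injective xs! i j eq)

  -- Pigeonhole: sending each index of `xs` to a position of the same element in `ys` is injective.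
  -- Both the cardinality and the edge-count inequalities below rest on this.
  unique-⊆⇒length≤ : ∀ {xs ys : List A} → Unique xs → xs ⊆ ys → length xs ≤ length ys
  unique-⊆⇒length≤ {xs} {ys} xs! xs⊆ys = Fin.injective⇒≤ {f = position} λ {i} {j} eq →
    lookup-injective xs! i j (trans (lookup-position i) (trans (cong (lookup ys) eq) (sym (lookup-position j))))
    where
    position : Fin (length xs) → Fin (length ys)
    position i = index (xs⊆ys (∈-lookup i))

    lookup-position : ∀ i → lookup xs i ≡ lookup ys (position i)
    lookup-position i = lookup-index (xs⊆ys (∈-lookup i))

-- Increasing pairs

sucPair : ∀ {m} → Fin m × Fin m → Fin (suc m) × Fin (suc m)
sucPair (i , j) = suc i , suc j

sucPair-injective : ∀ {m} {p q : Fin m × Fin m} → sucPair p ≡ sucPair q → p ≡ q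
sucPair-injective refl = refl

-- The edges of the complete graph on `m` vertices, those at vertex 0 listed first, so that they can
-- be counted by induction on `m`.
increasingPairs : ∀ m → List (Fin m × Fin m)
increasingPairs zero    = []
increasingPairs (suc m) =
  map (λ j → zero , suc j) (allFin m) ++ map sucPair (increasingPairs m)

increasingPairs-! : ∀ m → Unique (increasingPairs m)
increasingPairs-! zero    = []
increasingPairs-! (suc m) =
  ++⁺ (map⁺ (λ { refl → refl }) (allFin⁺ m)) (map⁺ sucPair-injective (increasingPairs-! m))
    λ (p , q) → disjoint (∈-map⁻ _ p) (∈-map⁻ _ q)
  where
  disjoint : ∀ {e} → (∃ λ j → j ∈ allFin m × e ≡ (zero , suc j)) →
    ¬ (∃ λ p → p ∈ increasingPairs m × e ≡ sucPair p)
  disjoint (_ , _ , refl) (_ , _ , ())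

∈-increasingPairs⁺ : ∀ {m} {i j : Fin m} → i Fin.< j → (i , j) ∈ increasingPairs m
∈-increasingPairs⁺ {i = zero}  {suc j} _         = ∈-++⁺ˡ (∈-map⁺ _ (∈-allFin j))
∈-increasingPairs⁺ {i = suc i} {suc j} (s<s i<j) = ∈-++⁺ʳ _ (∈-map⁺ _ (∈-increasingPairs⁺ i<j))

∈-increasingPairs⁻ : ∀ {m} {i j : Fin m} → (i , j) ∈ increasingPairs m → i Fin.< j
∈-increasingPairs⁻ {suc m} e∈ with ∈-++⁻ (map (λ j → zero , suc j) (allFin m)) e∈
... | inj₁ e∈ˡ with _ , _ , refl ← ∈-map⁻ _ e∈ˡ = z<s
... | inj₂ e∈ʳ with _ , p∈ , refl ← ∈-map⁻ _ e∈ʳ = s<s (∈-increasingPairs⁻ p∈)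

length-increasingPairs : ∀ m → length (increasingPairs m) ≡ (m * (m ∸ 1)) / 2
length-increasingPairs m =
  trans (sym (m*n/n≡m _ 2)) (cong (_/ 2) (doubled m))
  where
  step : ∀ m → m * 2 + m * (m ∸ 1) ≡ suc m * m
  step zero    = refl
  step (suc k) = identity k
    where
    identity : ∀ k → suc k * 2 + suc k * k ≡ suc (suc k) * suc k
    identity = solve-∀

  -- The induction runs on the doubled count, which keeps division out of the recurrence.
  doubled : ∀ m → length (increasingPairs m) * 2 ≡ m * (m ∸ 1)
  doubled zero    = refl
  doubled (suc m) = begin
    length (increasingPairs (suc m)) * 2
      ≡⟨ cong (_* 2) (length-++ (map (λ j → zero , suc j) (allFin m))) ⟩
    (length (map {B = Fin (suc m) × Fin (suc m)} (λ j → zero , suc j) (allFin m))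
      + length (map sucPair (increasingPairs m))) * 2
      ≡⟨ cong (_* 2) (cong₂ _+_ {u = length (map sucPair (increasingPairs m))}
           (trans (length-map (λ j → zero , suc j) (allFin m)) (length-tabulate {n = m} id))
           (length-map _ (increasingPairs m))) ⟩
    (m + length (increasingPairs m)) * 2
      ≡⟨ *-distribʳ-+ 2 m (length (increasingPairs m)) ⟩
    m * 2 + length (increasingPairs m) * 2
      ≡⟨ cong (m * 2 +_) (doubled m) ⟩
    m * 2 + m * (m ∸ 1)
      ≡⟨ step m ⟩
    suc m * m ∎
    where open ≡-Reasoning

punchIn-mono-< : ∀ {m} u {i j : Fin m} → i Fin.< j → punchIn u i Fin.< punchIn u j
punchIn-mono-< u {i} {j} i<j =
  ≤∧≢⇒< (Fin.punchIn-mono-≤ u i j (<⇒≤ i<j))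
    λ eq → <⇒≢ i<j (cong toℕ (Fin.punchIn-injective u i j (Fin.toℕ-injective eq)))

-- Cardinality of sumsets

∈-max : ∀ x xs → max x xs ∈ x ∷ xs
∈-max x xs with argmax-sel id x xs
... | inj₁ eq  = here eq
... | inj₂ ∈xs = there ∈xs

≤-max : ∀ {x xs a} → a ∈ x ∷ xs → a ≤ max x xs
≤-max {x} {xs} (here refl) = ⊥≤max x xs
≤-max {x} {xs} (there a∈)  = All.lookup (xs≤max x xs) a∈

-- The translate A + b misses max A + b′.
card<card-sumset : ∀ {A C : FinSet} {b b′} → A ≢ [] → b < b′ →
  (∀ {a} → a ∈ A → a + b ∈ C) → (∀ {a} → a ∈ A → a + b′ ∈ C) → card A < card C
card<card-sumset {[]} A≢[] = contradiction refl A≢[]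
card<card-sumset {A@(x ∷ xs)} {C} {b} {b′} _ b<b′ +b∈C +b′∈C =
  subst (λ k → suc k ≤ card C) (length-map (_+ b) (deduplicate _≟_ A))
    (unique-⊆⇒length≤ extended-! extended⊆C)
  where
  translate : List ℕ
  translate = map (_+ b) (deduplicate _≟_ A)

  extended-! : Unique (max x xs + b′ ∷ translate)
  extended-! =
    All.map⁺ (All.tabulate λ a∈ eq →
      <⇒≢ (+-mono-≤-< (≤-max (∈-deduplicate⁻ _≟_ A a∈)) b<b′) (sym eq))
    ∷ map⁺ (λ {a} {a′} → +-cancelʳ-≡ b a a′) (deduplicate-! A)

  extended⊆C : (max x xs + b′ ∷ translate) ⊆ deduplicate _≟_ C
  extended⊆C (here refl) = ∈-deduplicate⁺ _≟_ (+b′∈C (∈-max x xs))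
  extended⊆C (there c∈) with _ , a∈ , refl ← ∈-map⁻ (_+ b) c∈ =
    ∈-deduplicate⁺ _≟_ (+b∈C (∈-deduplicate⁻ _≟_ A a∈))

card≢1⇒two-elements : ∀ A → A ≢ [] → card A ≢ 1 → ∃₂ λ a b → a ∈ A × b ∈ A × a < b
card≢1⇒two-elements A A≢[] card≢1
  -- The deduplicated list is abstracted together with its properties, so that one case split on its
  -- shape refines them all.
  with deduplicate _≟_ A | deduplicate-! A | ∈-deduplicate⁻ _≟_ A | ∈-deduplicate⁺ _≟_ {A}
card≢1⇒two-elements []      A≢[] _ | [] | _ | _ | _ = contradiction refl A≢[]
card≢1⇒two-elements (x ∷ _) _    _ | [] | _ | _ | x∈[] with () ← x∈[] (here refl)
card≢1⇒two-elements _ _ card≢1 | _ ∷ [] | _ | _ | _ = contradiction refl card≢1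
card≢1⇒two-elements _ _ _ | x ∷ y ∷ _ | (x∉ ∷ _) | ∈A | _ with <-cmp x y
... | tri< x<y _ _ = x , y , ∈A (here refl) , ∈A (there (here refl)) , x<y
... | tri≈ _ x≡y _ = contradiction x≡y (All.lookup x∉ (here refl))
... | tri> _ _ y<x = y , x , ∈A (there (here refl)) , ∈A (here refl) , y<x

-- If both sets had two distinct elements, the sumset would be strictly larger than each of them,
-- hence larger than the maximum.
card-⊕-tight⇒card≡1 : ∀ A B → A ≢ [] → B ≢ [] → card (A ⊕ B) ≡ card A ⊔ card B →
  card A ≢ 1 → card B ≡ 1
card-⊕-tight⇒card≡1 A B A≢[] B≢[] tight cardA≢1 = decidable-stable (card B ≟ 1) λ cardB≢1 →
  let a , a′ , a∈ , a′∈ , a<a′ = card≢1⇒two-elements A A≢[] cardA≢1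
      b , b′ , b∈ , b′∈ , b<b′ = card≢1⇒two-elements B B≢[] cardB≢1
      A<A⊕B = card<card-sumset A≢[] b<b′
        (λ x∈ → ∈-cartesianProductWith⁺ _+_ x∈ b∈) (λ x∈ → ∈-cartesianProductWith⁺ _+_ x∈ b′∈)
      B<A⊕B = card<card-sumset B≢[] a<a′
        (λ {y} y∈ → subst (_∈ A ⊕ B) (+-comm a y) (∈-cartesianProductWith⁺ _+_ a∈ y∈))
        (λ {y} y∈ → subst (_∈ A ⊕ B) (+-comm a′ y) (∈-cartesianProductWith⁺ _+_ a′∈ y∈))
  in <⇒≢ (⊔-lub A<A⊕B B<A⊕B) (sym tight)

card-pair : ∀ {x y} → x ≢ y → card (x ∷ y ∷ []) ≡ 2
card-pair {x} x≢y = cong (suc ∘ length) (filter-accept (¬? ∘ (x ≟_)) x≢y)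

-- Equality of sets with one or two elements

≋-⊆ : ∀ {A B} → A ≋ B → A ⊆ B
≋-⊆ A≋B = Equivalence.to A≋B

≋-⊇ : ∀ {A B} → A ≋ B → B ⊆ A
≋-⊇ A≋B = Equivalence.from A≋B

≋-sym : ∀ {A B} → A ≋ B → B ≋ A
≋-sym A≋B = ⇔-sym A≋B

singleton-≋⇒≡ : ∀ {x y} → [ x ] ≋ [ y ] → x ≡ y
singleton-≋⇒≡ eq with here x≡y ← ≋-⊆ eq (here refl) = x≡y

pair-≋-singleton⇒≡ : ∀ {x y z} → (x ∷ y ∷ []) ≋ [ z ] → x ≡ y
pair-≋-singleton⇒≡ eq
  with here x≡z ← ≋-⊆ eq (here refl) | here y≡z ← ≋-⊆ eq (there (here refl)) =
  trans x≡z (sym y≡z)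

consecutive-≋⇒≡ : ∀ {x y} → (x ∷ suc x ∷ []) ≋ (y ∷ suc y ∷ []) → x ≡ y
consecutive-≋⇒≡ eq with ≋-⊆ eq (here refl) | ≋-⊇ eq (here refl)
... | here x≡y            | _                   = x≡y
... | there (here _)      | here y≡x            = sym y≡x
-- Each of `x` and `y` would be the successor of the other.
... | there (here refl)   | there (here y≡2+y)  = contradiction y≡2+y (<⇒≢ (s≤s (n≤1+n _)))

-- Sums of two powers of 2

2^-mono-< : ∀ {a b} → a < b → 2 ^ a < 2 ^ b
2^-mono-< = ^-monoʳ-< 2 (s≤s (s≤s z≤n))

2^-injective : ∀ {a b} → 2 ^ a ≡ 2 ^ b → a ≡ b
2^-injective {a} {b} eq with <-cmp a b
... | tri< a<b _ _ = contradiction eq (<⇒≢ (2^-mono-< a<b))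
... | tri≈ _ a≡b _ = a≡b
... | tri> _ _ b<a = contradiction (sym eq) (<⇒≢ (2^-mono-< b<a))

-- The larger exponent decides: a sum with top exponent `b` stays below `2 ^ suc b`, which is at
-- most `2 ^ d`.
2^-sum-< : ∀ {a b c d} → a < b → b < d → 2 ^ a + 2 ^ b < 2 ^ c + 2 ^ d
2^-sum-< {a} {b} {c} {d} a<b b<d = begin-strict
  2 ^ a + 2 ^ b       <⟨ +-monoˡ-< (2 ^ b) (2^-mono-< a<b) ⟩
  2 ^ b + 2 ^ b       ≡⟨ cong (2 ^ b +_) (+-identityʳ (2 ^ b)) ⟨
  2 ^ suc b           ≤⟨ ^-monoʳ-≤ 2 b<d ⟩
  2 ^ d               ≤⟨ m≤n+m (2 ^ d) (2 ^ c) ⟩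
  2 ^ c + 2 ^ d       ∎
  where open ≤-Reasoning

-- This is uniqueness of binary expansions with two digits 1: the top exponents must agree, and
-- cancelling them leaves the lower ones.
2^-sum-injective : ∀ {a b c d} → a < b → c < d →
  2 ^ a + 2 ^ b ≡ 2 ^ c + 2 ^ d → a ≡ c × b ≡ d
2^-sum-injective {a} {b} {c} {d} a<b c<d eq with <-cmp b d
... | tri< b<d _ _  = contradiction eq (<⇒≢ (2^-sum-< {c = c} a<b b<d))
... | tri≈ _ refl _ = 2^-injective (+-cancelʳ-≡ (2 ^ b) _ _ eq) , refl
... | tri> _ _ d<b  = contradiction (sym eq) (<⇒≢ (2^-sum-< {c = a} c<d d<b))

-- Complete graphs

module _ {m : ℕ} (H : Graph (suc m)) (complete : ∀ {u v} → u ≢ v → Graph.Adj H u v) where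

  monoIndexedEdges : (Fin (suc m) → FinSet) → List (Fin (suc m) × Fin (suc m))
  monoIndexedEdges f = filter (monoIndexed? f) (edges H)

  ∈-monoIndexedEdges⁺ : ∀ f {u v} → u Fin.< v → MonoIndexed f (u , v) →
    (u , v) ∈ monoIndexedEdges f
  ∈-monoIndexedEdges⁺ f {u} {v} u<v mono =
    ∈-filter⁺ (monoIndexed? f)
      (∈-filter⁺ (isEdge? H) (∈-cartesianProduct⁺ (∈-allFin u) (∈-allFin v))
        (u<v , complete λ { refl → <-irrefl refl u<v }))
      mono

  ∈-monoIndexedEdges⁻ : ∀ f {e} → e ∈ monoIndexedEdges f → IsEdge H e × MonoIndexed f e
  ∈-monoIndexedEdges⁻ f e∈ =
    let e∈edges , mono = ∈-filter⁻ (monoIndexed? f) e∈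
    in proj₂ (∈-filter⁻ (isEdge? H) {xs = cartesianProduct (allFin _) (allFin _)} e∈edges) , mono

  monoIndexedEdges-! : ∀ f → Unique (monoIndexedEdges f)
  monoIndexedEdges-! f =
    filter⁺ (monoIndexed? f) (filter⁺ (isEdge? H) (cartesianProduct⁺ (allFin⁺ _) (allFin⁺ _)))

  module _ {f} (wiasi : IsWIASI H f) where
    open IsWIASI wiasi
    open IsIASI isIASI

    -- Every other vertex is adjacent to a vertex with a non-singleton label, so weakness forces its
    -- label to be a singleton.
    all-but-one-mono : ∃ λ u₀ → ∀ {v} → v ≢ u₀ → card (f v) ≡ 1
    all-but-one-mono with Fin.any? (λ u → ¬? (card (f u) ≟ 1))
    ... | yes (u₀ , card≢1) = u₀ , λ {v} v≢u₀ →
      card-⊕-tight⇒card≡1 (f u₀) (f v) (nonEmpty u₀) (nonEmpty v)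
        (weak (complete (v≢u₀ ∘ sym))) card≢1
    -- All labels are singletons here, so any vertex could serve as `u₀`.
    ... | no ∄u = zero , λ {v} _ → decidable-stable (card (f v) ≟ 1) λ card≢1 → ∄u (v , card≢1)

    -- Edges avoiding `u₀` have singleton labels at both ends. Renumbering by `punchIn u₀`
    -- identifies them with the edges of the complete graph on `m` vertices and preserves the order
    -- of endpoints.
    monoIndexedEdgeCount-≥ : length (increasingPairs m) ≤ monoIndexedEdgeCount H f
    monoIndexedEdgeCount-≥ with u₀ , mono ← all-but-one-mono =
      subst (_≤ monoIndexedEdgeCount H f) (length-map avoid (increasingPairs m))
        (unique-⊆⇒length≤ (map⁺ avoid-injective (increasingPairs-! m)) avoid⊆mono)
      where
      avoid : Fin m × Fin m → Fin (suc m) × Fin (suc m)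
      avoid = Product.map (punchIn u₀) (punchIn u₀)

      avoid-injective : ∀ {p q} → avoid p ≡ avoid q → p ≡ q
      avoid-injective {i , j} {k , l} eq with eq₁ , eq₂ ← ,-injective eq =
        cong₂ _,_ (Fin.punchIn-injective u₀ i k eq₁) (Fin.punchIn-injective u₀ j l eq₂)

      avoid⊆mono : map avoid (increasingPairs m) ⊆ monoIndexedEdges f
      avoid⊆mono e∈ with (i , j) , p∈ , refl ← ∈-map⁻ avoid e∈ =
        ∈-monoIndexedEdges⁺ f i<j
          (trans (weak (complete (<⇒≢ i<j ∘ cong toℕ)))
                 (cong₂ _⊔_ (mono (Fin.punchInᵢ≢i u₀ i)) (mono (Fin.punchInᵢ≢i u₀ j))))
        where
        i<j : punchIn u₀ i Fin.< punchIn u₀ j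
        i<j = punchIn-mono-< u₀ (∈-increasingPairs⁻ p∈)

  -- A labelling that attains the bound

  powerLabel : Fin (suc m) → FinSet
  powerLabel zero      = 0 ∷ 1 ∷ []
  powerLabel u@(suc _) = [ 2 ^ toℕ u ]

  -- Edges at vertex 0 carry two consecutive numbers starting at a power of 2, and all other edges
  -- carry a single sum of two distinct powers of 2. Cardinality separates the two kinds; the least
  -- element or the binary expansion separates edges of the same kind.
  powerLabel-isIASI : IsIASI H powerLabel
  powerLabel-isIASI = record
    { nonEmpty         = λ { zero () ; (suc _) () }
    ; vertex-injective = λ {u} {v} → vertex-inj u v
    ; edge-injective   = λ {e} {e′} (u<v , _) (u′<v′ , _) → edge-inj e e′ u<v u′<v′
    }
    where
    vertex-inj : ∀ u v → powerLabel u ≋ powerLabel v → u ≡ v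
    vertex-inj zero    zero    _  = refl
    vertex-inj zero    (suc v) eq = contradiction (pair-≋-singleton⇒≡ eq) λ ()
    vertex-inj (suc u) zero    eq = contradiction (pair-≋-singleton⇒≡ (≋-sym eq)) λ ()
    vertex-inj (suc u) (suc v) eq = Fin.toℕ-injective (2^-injective (singleton-≋⇒≡ eq))

    edge-inj : ∀ e e′ → proj₁ e Fin.< proj₂ e → proj₁ e′ Fin.< proj₂ e′ →
      edgeLabel powerLabel e ≋ edgeLabel powerLabel e′ → e ≡ e′
    edge-inj (zero , suc v) (zero , suc v′) _ _ eq =
      cong (zero ,_) (Fin.toℕ-injective (2^-injective (consecutive-≋⇒≡ eq)))
    edge-inj (zero , suc v) (suc _ , suc _) _ _ eq =
      contradiction (pair-≋-singleton⇒≡ eq) (<⇒≢ (n<1+n _))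
    edge-inj (suc _ , suc _) (zero , suc v′) _ _ eq =
      contradiction (pair-≋-singleton⇒≡ (≋-sym eq)) (<⇒≢ (n<1+n _))
    edge-inj (suc _ , suc _) (suc _ , suc _) u<v u′<v′ eq =
      let u≡u′ , v≡v′ = 2^-sum-injective u<v u′<v′ (singleton-≋⇒≡ eq)
      in cong₂ _,_ (Fin.toℕ-injective u≡u′) (Fin.toℕ-injective v≡v′)

  powerLabel-isWIASI : IsWIASI H powerLabel
  powerLabel-isWIASI = record { isIASI = powerLabel-isIASI ; weak = λ {u} {v} → weak u v }
    where
    weak : ∀ u v → Graph.Adj H u v →
      card (powerLabel u ⊕ powerLabel v) ≡ card (powerLabel u) ⊔ card (powerLabel v)
    weak zero    zero    u~u = contradiction u~u (Graph.adj-irrefl H)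
    weak zero    (suc v) _   = card-pair {2 ^ toℕ (suc v)} (<⇒≢ (n<1+n _))
    weak (suc u) zero    _   = card-pair (<⇒≢ (+-monoʳ-< (2 ^ toℕ (suc u)) z<s))
    weak (suc _) (suc _) _   = refl

  -- An edge at vertex 0 has a two-element label, so mono-indexed edges have both ends in the image
  -- of `suc`. With the lower bound for all weak IASIs, this inequality yields equality.
  monoIndexedEdgeCount-powerLabel-≤ :
    monoIndexedEdgeCount H powerLabel ≤ length (increasingPairs m)
  monoIndexedEdgeCount-powerLabel-≤ =
    subst (monoIndexedEdgeCount H powerLabel ≤_)
      (length-map sucPair (increasingPairs m))
      (unique-⊆⇒length≤ (monoIndexedEdges-! powerLabel) λ {e} e∈ →
        let (u<v , _) , mono = ∈-monoIndexedEdges⁻ powerLabel e∈ in avoids-zero e u<v mono)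
    where
    avoids-zero : ∀ e → proj₁ e Fin.< proj₂ e → MonoIndexed powerLabel e →
      e ∈ map sucPair (increasingPairs m)
    avoids-zero (zero  , suc v) _         mono
      with () ← trans (sym (card-pair {2 ^ toℕ (suc v)} (<⇒≢ (n<1+n _)))) mono
    avoids-zero (suc u , suc v) (s<s u<v) _ = ∈-map⁺ _ (∈-increasingPairs⁺ u<v)

  complete-sparingNumber : IsSparingNumber H ((m * (m ∸ 1)) / 2)
  complete-sparingNumber = subst (IsSparingNumber H) (length-increasingPairs m) record
    { attained = powerLabel , powerLabel-isWIASI ,
        ≤-antisym monoIndexedEdgeCount-powerLabel-≤ (monoIndexedEdgeCount-≥ powerLabel-isWIASI)
    ; minimal  = λ _ → monoIndexedEdgeCount-≥
    }

-- Distances in split graphs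

module _ {n : ℕ} (G : Graph n) where
  open Graph G

  _++ʷ_ : ∀ {k l u v w} → Walk G k u v → Walk G l v w → Walk G (k + l) u w
  nil      ++ʷ q = q
  cons a p ++ʷ q = cons a (p ++ʷ q)

  -- Strong induction on the length: either some shorter walk joins the same ends, or the given
  -- length is itself the distance.
  walk⇒distanceAtMost : ∀ {u v} k → Walk G k u v → DistanceAtMost G k u v
  walk⇒distanceAtMost {u} {v} = <-rec _ λ k rec p → shortest k rec p
    where
    shortest : ∀ k → (∀ {j} → j < k → Walk G j u v → DistanceAtMost G j u v) →
      Walk G k u v → DistanceAtMost G k u v
    shortest k rec p with anyUpTo? (λ j → walk? G j u v) k
    ... | yes (j , j<k , q) =
      let d , d≤j , dist = rec j<k q in d , ≤-trans d≤j (<⇒≤ j<k) , dist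
    ... | no ∄shorter = k , ≤-refl , p , λ j<k q → ∄shorter (_ , j<k , q)

  module _ {r s} (split : SplitPartition G r s) where
    open SplitPartition split

    r+s≡n : r + s ≡ n
    r+s≡n = trans (cong₂ _+_ (sym ∣K∣≡r) (trans (sym ∣∁K∣≡s) (Subset.∣∁p∣≡n∸∣p∣ K)))
                  (m+[n∸m]≡n (Subset.∣p∣≤n K))

    module _ (noIsolated : NoIsolatedVertices G) where

      -- A vertex outside `K` has a neighbour, and independence of the complement puts that
      -- neighbour in `K`.
      walk-to-K : ∀ u → ∃₂ λ k x → k ≤ 1 × x Subset.∈ K × Walk G k u x
      walk-to-K u with u Subset.∈? K
      ... | yes u∈K = 0 , u , z≤n , u∈K , nil
      ... | no  u∉K =
        let w , u~w = noIsolated u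
            w∈K = Subset.x∉∁p⇒x∈p λ w∈∁K → independent (Subset.x∉p⇒x∈∁p u∉K) w∈∁K u~w
        in 1 , w , ≤-refl , w∈K , cons u~w nil

      walk-within-K : ∀ {x y} → x Subset.∈ K → y Subset.∈ K → ∃ λ k → k ≤ 1 × Walk G k x y
      walk-within-K {x} {y} x∈K y∈K with x Fin.≟ y
      ... | yes refl = 0 , z≤n , nil
      ... | no  x≢y  = 1 , ≤-refl , cons (clique x∈K y∈K x≢y) nil

      split-diameter≤3 : ∀ u v → DistanceAtMost G 3 u v
      split-diameter≤3 u v =
        let k , x , k≤1 , x∈K , p = walk-to-K u
            l , y , l≤1 , y∈K , q = walk-to-K v
            j , j≤1 , c = walk-within-K x∈K y∈K
            -- From `u` into the clique, across it, and out to `v`: three walks of length at most 1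
            -- each.
            d , d≤ , dist = walk⇒distanceAtMost _ (p ++ʷ (c ++ʷ reverseWalk G q))
        in d , ≤-trans d≤ (+-mono-≤ k≤1 (+-mono-≤ j≤1 l≤1)) , dist

mainTheorem7 : ∀ {n r s : ℕ} (G : Graph n) →
    NoIsolatedVertices G → Connected G → SplitPartition G r s →
    ∀ (t : ℕ) → 3 ≤ t →
    IsSparingNumber (power G t) (((r + s ∸ 1) * (r + s ∸ 2)) / 2)
mainTheorem7 {zero} G _ connected with () ← Connected.nonEmpty connected
mainTheorem7 {suc m} G noIsolated _ split t 3≤t =
  -- At `k = suc m` the two factors reduce to `m` and `m ∸ 1`, the count for a complete graph on
  -- `suc m` vertices.
  subst (λ k → IsSparingNumber (power G t) (((k ∸ 1) * (k ∸ 2)) / 2)) (sym (r+s≡n G split))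
    (complete-sparingNumber (power G t) λ {u} {v} u≢v →
      let d , d≤3 , dist = split-diameter≤3 G split noIsolated u v
      in u≢v , d , ≤-trans d≤3 3≤t , dist)
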